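{- Let $G$ be a $2$-connected non-Hamiltonian graph of order $n\ge 4$. Then $px_3(G)\le\lfloor n/2\rfloor$.
   Context: All graphs are finite, simple and undirected. In an edge-colored graph (adjacent edges may receive the same color), a tree is proper if no two adjacent edges of it receive the same color. For a connected graph $G$ and $S\subseteq V(G)$, an $S$-tree is a tree in $G$ containing all vertices of $S$. An edge-coloring of $G$ is a $3$-proper coloring if for every $3$-subset $S$ of $V(G)$ there is a proper $S$-tree in $G$; $px_3(G)$ is the minimum number of colors in a $3$-proper coloring of $G$. -}

module Defs where

open import Level using (0ℓ)
open import Data.Nat using (ℕ; suc; _≤_)
open import Data.Fin using (Fin)
open import Data.List using (List; _∷_; []; _++_; length)
open import Data.List.Relation.Unary.Linked using (Linked)
open import Data.List.Relation.Unary.Unique.Propositional using (Unique)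
open import Data.Product using (Σ; _×_; ∃; ∃-syntax)
open import Data.Empty using (⊥)
open import Relation.Nullary using (¬_)
open import Relation.Binary.PropositionalEquality using (_≡_; _≢_)

record Graph (n : ℕ) : Set₁ where
  field
    Adj    : Fin n → Fin n → Set
    sym    : ∀ {u v} → Adj u v → Adj v u
    irrefl : ∀ {u} → ¬ Adj u u
open Graph public

data Reach {n : ℕ} (E : Fin n → Fin n → Set) : Fin n → Fin n → Set where
  here : ∀ {u} → Reach E u u
  step : ∀ {u v w} → E u v → Reach E v w → Reach E u w

IsCycle : {n : ℕ} → (Fin n → Fin n → Set) → Fin n → List (Fin n) → Set
IsCycle E x xs =
  (3 ≤ length (x ∷ xs)) × Unique (x ∷ xs) × Linked E ((x ∷ xs) ++ (x ∷ []))

Connected : {n : ℕ} → Graph n → Set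
Connected G = ∀ u v → Reach (Adj G) u v

ConnectedWithout : {n : ℕ} → Graph n → Fin n → Set
ConnectedWithout G x =
  ∀ u v → u ≢ x → v ≢ x →
    Reach (λ a b → Adj G a b × a ≢ x × b ≢ x) u v

TwoConnected : {n : ℕ} → Graph n → Set
TwoConnected {n} G = 3 ≤ n × Connected G × (∀ x → ConnectedWithout G x)

Hamiltonian : {n : ℕ} → Graph n → Set
Hamiltonian {n} G =
  ∃[ x ] ∃[ xs ] (IsCycle (Adj G) x xs × length (x ∷ xs) ≡ n)

-- An edge-colouring of G with (at most) k colours: symmetric colour
-- function on vertex pairs (only values on edges matter).
record EdgeColouring {n : ℕ} (G : Graph n) (k : ℕ) : Set where
  field
    col     : Fin n → Fin n → Fin k
    col-sym : ∀ u v → col u v ≡ col v u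
open EdgeColouring public

record IsTree {n : ℕ} (G : Graph n) (V : Fin n → Set)
              (T : Fin n → Fin n → Set) : Set where
  field
    T-sym   : ∀ {u v} → T u v → T v u
    T-edge  : ∀ {u v} → T u v → Adj G u v
    T-ends  : ∀ {u v} → T u v → V u × V v
    T-conn  : ∀ {u v} → V u → V v → Reach T u v
    T-acyc  : ∀ x xs → ¬ IsCycle T x xs

ProperTree : {n k : ℕ} {G : Graph n} → EdgeColouring G k →
             (Fin n → Fin n → Set) → Set
ProperTree c T =
  ∀ {u v w} → T u v → T v w → u ≢ w → col c u v ≢ col c v w

ThreeProper : {n k : ℕ} {G : Graph n} → EdgeColouring G k → Set₁
ThreeProper {n} {k} {G} c =
  ∀ x y z → x ≢ y → y ≢ z → x ≢ z →
    Σ (Fin n → Set) λ V → Σ (Fin n → Fin n → Set) λ T →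
      IsTree G V T × V x × V y × V z × ProperTree c T

px3≤ : {n : ℕ} → Graph n → ℕ → Set₁
px3≤ G k = Σ (EdgeColouring G k) ThreeProper

{-# OPTIONS --safe #-}
module Submission where

-- A spanning tree of maximum degree d has a proper edge-colouring with d
-- colours, and then serves as the proper S-tree for every S. So it suffices to
-- find a spanning tree of maximum degree at most m = ⌊n/2⌋. Root a spanning tree
-- at a vertex r of degree more than m (there is at most one); counting gives a
-- leaf l below r, and 2-connectedness a neighbour x ≠ r of l. If x is a child of
-- r, hang x below l; otherwise hang l below x, whose degree is small because
-- N(r) and the children of x are disjoint. Either way deg r drops by one and
-- no other degree exceeds m.

open import Defs
open import Data.Nat using (ℕ; _≤_; _/_)
open import Relation.Nullary using (¬_)

open import Data.Nat using (zero; suc; z≤n; s≤s; _<_; _+_; _*_; _%_; _<?_; _≤?_)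
open import Data.Nat.Properties
open import Data.Nat.DivMod using (m≡m%n+[m/n]*n; m%n<n; /-monoˡ-≤)
open import Data.Fin using (Fin; zero; suc; fromℕ<; toℕ)
import Data.Fin as Fin
open import Data.Fin.Properties using (any?; injective⇒≤; toℕ-fromℕ<)
  renaming (_≟_ to _≟F_; _<?_ to _<F?_; <-cmp to <F-cmp; <-irrefl to <F-irrefl; <-trans to <F-trans)
open import Data.List using (List; []; _∷_; _++_; length; lookup; filter; allFin; map)
open import Data.List.Properties using (length-tabulate; length-++; length-map; map-∘; map-id-local)
open import Data.List.Membership.Propositional using (_∈_; _∉_; find)
open import Data.List.Membership.Propositional.Properties using (∈-lookup; ∈-filter⁺; ∈-filter⁻; ∈-allFin; ∈-map⁻; ∈-++⁻; ∈-length)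
import Data.List.Membership.Setoid.Properties as SetoidMembership
open import Data.List.Relation.Binary.Subset.Propositional using (_⊆_)
open import Data.List.Relation.Unary.All as All using (All; []; _∷_)
open import Data.List.Relation.Unary.All.Properties using (¬Any⇒All¬)
open import Data.List.Relation.Unary.AllPairs using ([]; _∷_)
open import Data.List.Relation.Unary.Any as Any using (here; there)
open import Data.List.Relation.Unary.Linked using (Linked; _∷_)
open import Data.List.Relation.Unary.Unique.Propositional using (Unique)
open import Data.List.Relation.Unary.Unique.Propositional.Properties using (++⁺; map⁻; allFin⁺; filter⁺; Unique[x∷xs]⇒x∉xs)
open import Data.Product using (Σ; ∃; _×_; _,_; proj₁; proj₂)
open import Data.Sum using (_⊎_; inj₁; inj₂)
open import Data.Unit using (⊤; tt)
open import Data.Vec.Functional using (updateAt)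
open import Data.Vec.Functional.Properties using (updateAt-updates; updateAt-minimal)
open import Function using (_∘_; const)
open import Relation.Binary.Definitions using (tri<; tri≈; tri>)
open import Relation.Binary.PropositionalEquality using (_≡_; _≢_; refl; trans; cong; subst; setoid)
  renaming (sym to ≡-sym)
open import Relation.Nullary using (Dec; yes; no; contradiction)
open import Relation.Nullary.Decidable using (_×-dec_; ¬?; decidable-stable)

-- Counting with duplicate-free lists, and arithmetic.

private variable
  A : Set

∉⇒Unique-∷ : ∀ {x : A} {xs} → x ∉ xs → Unique xs → Unique (x ∷ xs)
∉⇒Unique-∷ x∉xs xs! = ¬Any⇒All¬ _ x∉xs ∷ xs!

lookup-injective : ∀ {xs : List A} → Unique xs → ∀ i j → lookup xs i ≡ lookup xs j → i ≡ j
lookup-injective {xs = _ ∷ _} _          zero    zero    _  = refl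
lookup-injective {xs = _ ∷ _} (x∉xs ∷ _) zero    (suc j) eq = contradiction eq (All.lookup x∉xs (∈-lookup j))
lookup-injective {xs = _ ∷ _} (x∉xs ∷ _) (suc i) zero    eq = contradiction (≡-sym eq) (All.lookup x∉xs (∈-lookup i))
lookup-injective {xs = _ ∷ _} (_ ∷ xs!)  (suc i) (suc j) eq = cong suc (lookup-injective xs! i j eq)

-- Pigeonhole: sending each position of `xs` to that of its entry in `ys` is injective. All counting
-- of vertices below goes through this.
Unique-⊆⇒length≤ : ∀ {xs ys : List A} → Unique xs → xs ⊆ ys → length xs ≤ length ys
Unique-⊆⇒length≤ {A = A} xs! xs⊆ys = injective⇒≤ λ {i} {j} eq →
  lookup-injective xs! i j
    (SetoidMembership.index-injective (setoid A) (xs⊆ys (∈-lookup i)) (xs⊆ys (∈-lookup j)) eq)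

Unique⇒length≤n : ∀ {n} {xs : List (Fin n)} → Unique xs → length xs ≤ n
Unique⇒length≤n {n} {xs} xs! = subst (length xs ≤_) (length-tabulate {n = n} (λ i → i))
  (Unique-⊆⇒length≤ xs! (λ {x} _ → ∈-allFin x))

n≤1+[n/2]+[n/2] : ∀ n → n ≤ suc (n / 2 + n / 2)
n≤1+[n/2]+[n/2] n = begin
  n                    ≡⟨ m≡m%n+[m/n]*n n 2 ⟩
  n % 2 + n / 2 * 2    ≤⟨ +-monoˡ-≤ (n / 2 * 2) (≤-pred (m%n<n n 2)) ⟩
  1 + n / 2 * 2        ≡⟨ cong suc (trans (*-comm (n / 2) 2) (cong (n / 2 +_) (+-identityʳ (n / 2)))) ⟩
  suc (n / 2 + n / 2)  ∎
  where open ≤-Reasoning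

-- The i-th natural number other than c.
skip : ℕ → ℕ → ℕ
skip c i with i <? c
... | yes _ = i
... | no  _ = suc i

skip-≢ : ∀ c i → skip c i ≢ c
skip-≢ c i eq with i <? c
... | yes i<c = <⇒≢ i<c eq
... | no  i≮c = i≮c (≤-reflexive eq)

skip-injective : ∀ c {i j} → skip c i ≡ skip c j → i ≡ j
skip-injective c {i} {j} eq with i <? c | j <? c
... | yes _   | yes _   = eq
... | yes i<c | no  j≮c = contradiction (<-trans (≤-reflexive (≡-sym eq)) i<c) j≮c
... | no  i≮c | yes j<c = contradiction (<-trans (≤-reflexive eq) j<c) i≮c
... | no  _   | no  _   = suc-injective eq

skip-below : ∀ {c i} → i < c → skip c i ≡ i
skip-below {c} {i} i<c with i <? c
... | yes _   = refl
... | no  i≮c = contradiction i<c i≮c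

skip-≤ : ∀ c i → skip c i ≤ suc i
skip-≤ c i with i <? c
... | yes _ = n≤1+n i
... | no  _ = ≤-refl

-- Walks.

module _ {n : ℕ} where

  Reach-trans : ∀ {E : Fin n → Fin n → Set} {u v w} → Reach E u v → Reach E v w → Reach E u w
  Reach-trans here       q = q
  Reach-trans (step e p) q = step e (Reach-trans p q)

  Reach-sym : ∀ {E : Fin n → Fin n → Set} → (∀ {u v} → E u v → E v u) →
              ∀ {u v} → Reach E u v → Reach E v u
  Reach-sym E-sym here       = here
  Reach-sym E-sym (step e p) = Reach-trans (Reach-sym E-sym p) (step (E-sym e) here)

  -- The first step of the walk that leaves `P`; it supplies the new edge when a spanning tree is
  -- grown.
  Reach-leaves : ∀ {E : Fin n → Fin n → Set} {P : Fin n → Set} → (∀ u → Dec (P u)) →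
                 ∀ {u w} → Reach E u w → P u → ¬ P w → ∃ λ a → ∃ λ b → E a b × P a × ¬ P b
  Reach-leaves P? here Pu ¬Pw = contradiction Pu ¬Pw
  Reach-leaves P? {u} (step {v = v} e p) Pu ¬Pw with P? v
  ... | yes Pv = Reach-leaves P? p Pv ¬Pw
  ... | no ¬Pv = u , v , e , Pu , ¬Pv

module _ {n : ℕ} (G : Graph n) where

  open import Data.List.Membership.DecPropositional (_≟F_ {n}) using (_∈?_)

  -- The value of par at the root is junk. The rank need not be the depth: any
  -- function decreasing along par witnesses that there is no cycle.
  record SpanningTree (r : Fin n) : Set where
    field
      par      : Fin n → Fin n
      rank     : Fin n → ℕ
      par-adj  : ∀ {u} → u ≢ r → Adj G u (par u)
      par-rank : ∀ {u} → u ≢ r → rank (par u) < rank u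

    ChildOf : Fin n → Fin n → Set
    ChildOf u w = u ≢ r × par u ≡ w

    childOf? : ∀ u w → Dec (ChildOf u w)
    childOf? u w = ¬? (u ≟F r) ×-dec (par u ≟F w)

    children : Fin n → List (Fin n)
    children w = filter (λ u → childOf? u w) (allFin n)

    #children : Fin n → ℕ
    #children w = length (children w)

    children-unique : ∀ w → Unique (children w)
    children-unique w = filter⁺ (λ u → childOf? u w) (allFin⁺ n)

    ∈-children⁺ : ∀ {u w} → ChildOf u w → u ∈ children w
    ∈-children⁺ {u} {w} = ∈-filter⁺ (λ v → childOf? v w) (∈-allFin u)

    ∈-children⁻ : ∀ {u w} → u ∈ children w → ChildOf u w
    ∈-children⁻ {u} {w} u∈ = proj₂ (∈-filter⁻ (λ v → childOf? v w) {xs = allFin n} u∈)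

    ChildOf-rank : ∀ {u w} → ChildOf u w → rank w < rank u
    ChildOf-rank (u≢r , refl) = par-rank u≢r

    ChildOf-asym : ∀ {u w} → ChildOf u w → ¬ ChildOf w u
    ChildOf-asym p q = <-asym (ChildOf-rank p) (ChildOf-rank q)

    ChildOf-irrefl : ∀ {u} → ¬ ChildOf u u
    ChildOf-irrefl p = ChildOf-asym p p

    ChildOf-functional : ∀ {u v w} → ChildOf u v → ChildOf u w → v ≡ w
    ChildOf-functional (_ , p) (_ , q) = trans (≡-sym p) q

    children-++-unique : ∀ {v w} → v ≢ w → Unique (children v ++ children w)
    children-++-unique v≢w = ++⁺ (children-unique _) (children-unique _)
      λ (u∈v , u∈w) → v≢w (ChildOf-functional (∈-children⁻ u∈v) (∈-children⁻ u∈w))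

    -- No vertex has two parents, so the two lists of children are disjoint; the root is in neither,
    -- which makes the bound strict.
    children-of-root+children<n : ∀ {w} → w ≢ r → #children r + #children w < n
    children-of-root+children<n {w} w≢r =
      subst (_< n) (length-++ (children r))
        (Unique⇒length≤n (∉⇒Unique-∷ r∉ (children-++-unique (w≢r ∘ ≡-sym))))
      where
      r∉ : r ∉ children r ++ children w
      r∉ r∈ with ∈-++⁻ (children r) r∈
      ... | inj₁ p = proj₁ (∈-children⁻ p) refl
      ... | inj₂ p = proj₁ (∈-children⁻ p) refl

    -- Now `w` too lies outside both lists. The unit gained pays for the child that `w` later
    -- receives.
    children-of-root+children<n-1 : ∀ {w} → w ≢ r → ¬ ChildOf w r →
                                    suc (#children r + #children w) < n
    children-of-root+children<n-1 {w} w≢r ¬w<r =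
      subst (λ k → suc k < n) (length-++ (children r))
        (Unique⇒length≤n (∉⇒Unique-∷ r∉ (∉⇒Unique-∷ w∉ (children-++-unique (w≢r ∘ ≡-sym)))))
      where
      w∉ : w ∉ children r ++ children w
      w∉ w∈ with ∈-++⁻ (children r) w∈
      ... | inj₁ p = ¬w<r (∈-children⁻ p)
      ... | inj₂ p = ChildOf-irrefl (∈-children⁻ p)
      r∉ : r ∉ w ∷ children r ++ children w
      r∉ (here r≡w) = w≢r (≡-sym r≡w)
      r∉ (there r∈) with ∈-++⁻ (children r) r∈
      ... | inj₁ p = proj₁ (∈-children⁻ p) refl
      ... | inj₂ p = proj₁ (∈-children⁻ p) refl

    firstChild : Fin n → Fin n
    firstChild c with children c
    -- A default value, excluded wherever `c` is known to have a child.
    ... | []    = r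
    ... | d ∷ _ = d

    firstChild-ChildOf : ∀ c → #children c ≢ 0 → ChildOf (firstChild c) c
    firstChild-ChildOf c ≢0 with children c in eq
    ... | []    = contradiction refl ≢0
    ... | d ∷ _ = ∈-children⁻ (subst (d ∈_) (≡-sym eq) (here refl))

    -- If every child of the root had a child, the root, its children and one
    -- grandchild per child would be more than n vertices.
    leaf-below-root : n < suc (#children r + #children r) →
                      ∃ λ l → ChildOf l r × #children l ≡ 0
    leaf-below-root n< with Any.any? (λ c → #children c ≟ 0) (children r)
    ... | yes p = let l , l∈ , eq = find p in l , ∈-children⁻ l∈ , eq
    ... | no ¬p = contradiction n< (≤⇒≯ (subst (_≤ n) (cong suc len) (Unique⇒length≤n all!)))
      where
      L = children r
      len : length (L ++ map firstChild L) ≡ length L + length L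
      len = trans (length-++ L) (cong (length L +_) (length-map firstChild L))
      below : ∀ {c} → c ∈ L → ChildOf (firstChild c) c
      below c∈ = firstChild-ChildOf _ (All.lookup (¬Any⇒All¬ L ¬p) c∈)
      -- Taking parents turns the list of grandchildren back into `L`, so a repetition there would
      -- be one in `L`.
      grandchildren! : Unique (map firstChild L)
      grandchildren! = map⁻ {f = par} (subst Unique
        (≡-sym (trans (≡-sym (map-∘ L)) (map-id-local (All.tabulate (proj₂ ∘ below)))))
        (children-unique r))
      disjoint : ∀ {u} → ¬ (u ∈ L × u ∈ map firstChild L)
      disjoint (u∈L , u∈) with ∈-map⁻ firstChild u∈
      ... | c , c∈ , refl = proj₁ (∈-children⁻ c∈)
                              (ChildOf-functional (below c∈) (∈-children⁻ u∈L))
      r∉ : r ∉ L ++ map firstChild L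
      r∉ r∈ with ∈-++⁻ L r∈
      ... | inj₁ p = proj₁ (∈-children⁻ p) refl
      ... | inj₂ p with ∈-map⁻ firstChild p
      ...   | c , c∈ , eq = proj₁ (below c∈) (≡-sym eq)
      all! : Unique (r ∷ L ++ map firstChild L)
      all! = ∉⇒Unique-∷ r∉ (++⁺ (children-unique r) grandchildren! disjoint)

    -- The undirected tree: connected and acyclic.

    Edge : Fin n → Fin n → Set
    Edge u w = ChildOf u w ⊎ ChildOf w u

    Edge-sym : ∀ {u w} → Edge u w → Edge w u
    Edge-sym (inj₁ p) = inj₂ p
    Edge-sym (inj₂ p) = inj₁ p

    Edge⇒Adj : ∀ {u w} → Edge u w → Adj G u w
    Edge⇒Adj (inj₁ (u≢r , refl)) = par-adj u≢r
    Edge⇒Adj (inj₂ (w≢r , refl)) = sym G (par-adj w≢r)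

    -- Climbing from parent to parent; `k` is fuel, and suffices because the rank drops at each
    -- step.
    reach-root : ∀ k u → rank u < k → Reach Edge u r
    reach-root (suc k) u (s≤s rank≤k) with u ≟F r
    ... | yes refl = here
    ... | no u≢r   = step (inj₁ (u≢r , refl))
                       (reach-root k (par u) (<-≤-trans (par-rank u≢r) rank≤k))

    Edge-connected : ∀ u w → Reach Edge u w
    Edge-connected u w = Reach-trans (reach-root _ u ≤-refl)
      (Reach-sym Edge-sym (reach-root _ w ≤-refl))

    -- A path which has once stepped from parent to child can only go on
    -- downwards, as stepping up would be stepping back.
    descending-from-start : ∀ {s p c} rest → ChildOf c p → rank s ≤ rank p →
      (rest ≡ [] → s ≢ p) → p ∉ rest → Unique (c ∷ rest) →
      ¬ Linked Edge (c ∷ rest ++ s ∷ [])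
    descending-from-start [] c<p s≤p s≢p _ _ (inj₁ c<s ∷ _) =
      s≢p refl (ChildOf-functional c<s c<p)
    descending-from-start [] c<p s≤p _ _ _ (inj₂ s<c ∷ _) =
      <-irrefl refl (<-≤-trans (<-trans (ChildOf-rank c<p) (ChildOf-rank s<c)) s≤p)
    descending-from-start (d ∷ rest) c<p _ _ p∉ _ (inj₁ c<d ∷ _) =
      p∉ (here (ChildOf-functional c<p c<d))
    descending-from-start (d ∷ rest) c<p s≤p _ _ (c∉ ∷ u) (inj₂ d<c ∷ L) =
      descending-from-start rest d<c (<⇒≤ s<c) (λ _ s≡c → <-irrefl (cong rank s≡c) s<c)
        (Unique[x∷xs]⇒x∉xs (c∉ ∷ u) ∘ there) u L
      where s<c = ≤-<-trans s≤p (ChildOf-rank c<p)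

    -- The path left `s` upwards and has turned down from `p` to `c`. Stepping up again would repeat
    -- `p`. It cannot close either: the parent of `c` is `p`, not `s`, and by hypothesis no vertex
    -- ahead is the parent of `s`.
    descending-after-ascent : ∀ {s p c} rest → ChildOf c p →
      All (s ≢_) (p ∷ c ∷ rest) → All (λ d → ¬ ChildOf s d) (c ∷ rest) →
      Unique (p ∷ c ∷ rest) → ¬ Linked Edge (c ∷ rest ++ s ∷ [])
    descending-after-ascent [] c<p (s≢p ∷ _) _ _ (inj₁ c<s ∷ _) =
      s≢p (ChildOf-functional c<s c<p)
    descending-after-ascent [] _ _ (s≮c ∷ _) _ (inj₂ s<c ∷ _) = s≮c s<c
    descending-after-ascent (d ∷ rest) c<p _ _ (p∉ ∷ _) (inj₁ c<d ∷ _) =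
      All.lookup p∉ (there (here refl)) (ChildOf-functional c<p c<d)
    descending-after-ascent (d ∷ rest) _ (_ ∷ s∉) (_ ∷ s≮) (_ ∷ u) (inj₂ d<c ∷ L) =
      descending-after-ascent rest d<c s∉ s≮ u L

    -- The path went from `s` up to its parent `q` and is still climbing, now at `c`. The rank keeps
    -- `c` from being a child of `s`, so it could close only at `c ≡ q`. At the start `c` is `q`,
    -- but `rest` is nonempty; afterwards `q` is never met again, which also gives the hypothesis
    -- needed once the path turns down.
    ascending : ∀ {s q c} rest → ChildOf s q → rank c < rank s →
      (rest ≡ [] → c ≢ q) → q ∉ rest → All (s ≢_) (c ∷ rest) → Unique (c ∷ rest) →
      ¬ Linked Edge (c ∷ rest ++ s ∷ [])
    ascending [] _ c<s _ _ _ _ (inj₁ c⋖s ∷ _) = <-asym c<s (ChildOf-rank c⋖s)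
    ascending [] s<q _ c≢q _ _ _ (inj₂ s⋖c ∷ _) = c≢q refl (ChildOf-functional s⋖c s<q)
    ascending (d ∷ rest) s<q c<s _ q∉ (_ ∷ s∉) (_ ∷ u) (inj₁ c⋖d ∷ L) =
      ascending rest s<q (<-trans (ChildOf-rank c⋖d) c<s) (λ _ d≡q → q∉ (here (≡-sym d≡q)))
        (q∉ ∘ there) s∉ u L
    ascending (d ∷ rest) s<q _ _ q∉ s∉ u (inj₂ d⋖c ∷ L) =
      descending-after-ascent rest d⋖c s∉
        (All.tabulate λ e∈ s<e → q∉ (subst (_∈ _) (ChildOf-functional s<e s<q) e∈)) u L

    Edge-acyclic : ∀ x xs → ¬ IsCycle Edge x xs
    Edge-acyclic x []      (s≤s () , _)
    Edge-acyclic x (_ ∷ []) (s≤s (s≤s ()) , _)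
    Edge-acyclic x (y ∷ z ∷ zs) (_ , (x∉ ∷ u) , (inj₁ x<y ∷ L)) =
      ascending (z ∷ zs) x<y (ChildOf-rank x<y) (λ ()) (Unique[x∷xs]⇒x∉xs u) x∉ u L
    Edge-acyclic x (y ∷ z ∷ zs) (_ , (x∉ ∷ u) , (inj₂ y<x ∷ L)) =
      descending-from-start (z ∷ zs) y<x ≤-refl (λ ())
        (Unique[x∷xs]⇒x∉xs (x∉ ∷ u) ∘ there) u L

    Edge-isTree : IsTree G (λ _ → ⊤) Edge
    Edge-isTree = record
      { T-sym  = Edge-sym
      ; T-edge = Edge⇒Adj
      ; T-ends = λ _ → tt , tt
      ; T-conn = λ _ _ → Edge-connected _ _
      ; T-acyc = Edge-acyclic
      }

  -- Proper edge-colouring of a rooted tree.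

  open SpanningTree

  -- Strict, because a vertex other than the root also has the edge to its parent: its degree is
  -- then at most `m`.
  BranchesBelow : ∀ {r} → ℕ → SpanningTree r → Set
  BranchesBelow {r} m T = ∀ {u} → u ≢ r → #children T u < m

  module ProperColouring {r : Fin n} (T : SpanningTree r) {m : ℕ} (2≤m : 2 ≤ m)
                         (root≤m : #children T r ≤ m) (others<m : BranchesBelow m T) where

    open SpanningTree T using () renaming (ChildOf to _⋖_; par to parT; rank to rankT)

    olderSiblings : Fin n → List (Fin n)
    olderSiblings u = filter (_<F? u) (children T (parT u))

    -- The index of `u` among its siblings, counted from zero in the order of `Fin n`.
    position : Fin n → ℕ
    position u = length (olderSiblings u)

    olderSiblings-unique : ∀ u → Unique (olderSiblings u)
    olderSiblings-unique u = filter⁺ (_<F? u) (children-unique T (parT u))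

    u∉olderSiblings : ∀ u → u ∉ olderSiblings u
    u∉olderSiblings u u∈ =
      <F-irrefl refl (proj₂ (∈-filter⁻ (_<F? u) {xs = children T (parT u)} u∈))

    position<#children : ∀ {u p} → u ⋖ p → position u < #children T p
    position<#children {u} (u≢r , refl) =
      Unique-⊆⇒length≤ (∉⇒Unique-∷ (u∉olderSiblings u) (olderSiblings-unique u)) λ where
        (here refl) → ∈-children⁺ T (u≢r , refl)
        (there w∈)  → proj₁ (∈-filter⁻ (_<F? u) {xs = children T (parT u)} w∈)

    position-mono : ∀ {u v p} → u ⋖ p → v ⋖ p → u Fin.< v → position u < position v
    position-mono {u} {v} (u≢r , refl) (v≢r , eq) u<v =
      Unique-⊆⇒length≤ (∉⇒Unique-∷ (u∉olderSiblings u) (olderSiblings-unique u)) λ where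
        (here refl) → ∈-filter⁺ (_<F? v) (∈-children⁺ T (u≢r , ≡-sym eq)) u<v
        (there w∈)  → let w∈ch , w<u = ∈-filter⁻ (_<F? u) {xs = children T (parT u)} w∈ in
          ∈-filter⁺ (_<F? v) (subst (λ p → _ ∈ children T p) (≡-sym eq) w∈ch) (<F-trans w<u u<v)

    position-injective : ∀ {u v p} → u ⋖ p → v ⋖ p → position u ≡ position v → u ≡ v
    position-injective {u} {v} u⋖p v⋖p eq with <F-cmp u v
    ... | tri< u<v _ _ = contradiction eq (<⇒≢ (position-mono u⋖p v⋖p u<v))
    ... | tri≈ _ u≡v _ = u≡v
    ... | tri> _ _ v<u = contradiction (≡-sym eq) (<⇒≢ (position-mono v⋖p u⋖p v<u))

    -- The colour of the edge from u to its parent. The root gets the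
    -- out-of-range value m, so that its children skip nothing.
    colourWithin : ℕ → Fin n → ℕ
    colourWithin zero    u = m
    colourWithin (suc k) u with u ≟F r
    ... | yes _ = m
    ... | no  _ = skip (colourWithin k (parT u)) (position u)

    colour : Fin n → ℕ
    colour u = colourWithin (rankT u) u

    colourWithin-root : ∀ k → colourWithin k r ≡ m
    colourWithin-root zero = refl
    colourWithin-root (suc k) with r ≟F r
    ... | yes _  = refl
    ... | no r≢r = contradiction refl r≢r

    colourWithin-suc : ∀ k {u} → u ≢ r →
      colourWithin (suc k) u ≡ skip (colourWithin k (parT u)) (position u)
    colourWithin-suc k {u} u≢r with u ≟F r
    ... | yes u≡r = contradiction u≡r u≢r
    ... | no _    = refl

    -- Fuel beyond the rank changes nothing. This turns the fuelled definition into the recursive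
    -- equation `colour-child`.
    colourWithin-stable : ∀ j k u → rankT u ≤ j → rankT u ≤ k →
                          colourWithin j u ≡ colourWithin k u
    colourWithin-stable j k u ≤j ≤k with u ≟F r
    ... | yes refl = trans (colourWithin-root j) (≡-sym (colourWithin-root k))
    ... | no u≢r   = go j k ≤j ≤k
      where
      go : ∀ j k → rankT u ≤ j → rankT u ≤ k → colourWithin j u ≡ colourWithin k u
      go zero    _       ≤j _  = contradiction (<-≤-trans (par-rank T u≢r) ≤j) λ ()
      go (suc _) zero    _  ≤k = contradiction (<-≤-trans (par-rank T u≢r) ≤k) λ ()
      go (suc j) (suc k) ≤j ≤k = trans (colourWithin-suc j u≢r) (trans
        (cong (λ c → skip c (position u))
          (colourWithin-stable j k (parT u)
            (≤-pred (<-≤-trans (par-rank T u≢r) ≤j)) (≤-pred (<-≤-trans (par-rank T u≢r) ≤k))))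
        (≡-sym (colourWithin-suc k u≢r)))

    colour-child : ∀ {u p} → u ⋖ p → colour u ≡ skip (colour p) (position u)
    colour-child {u} (u≢r , refl) = trans
      (colourWithin-stable (rankT u) (suc (rankT u)) u ≤-refl (n≤1+n _))
      (trans (colourWithin-suc (rankT u) u≢r)
        (cong (λ c → skip c (position u))
          (colourWithin-stable _ _ (parT u) (<⇒≤ (par-rank T u≢r)) ≤-refl)))

    colour-≢-parent : ∀ {u p} → u ⋖ p → colour u ≢ colour p
    colour-≢-parent {u} {p} u⋖p eq =
      skip-≢ (colour p) (position u) (trans (≡-sym (colour-child u⋖p)) eq)

    colour-≢-sibling : ∀ {u v p} → u ⋖ p → v ⋖ p → u ≢ v → colour u ≢ colour v
    colour-≢-sibling {u} {v} {p} u⋖p v⋖p u≢v eq = u≢v (position-injective u⋖p v⋖p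
      (skip-injective (colour p)
        (trans (≡-sym (colour-child u⋖p)) (trans eq (colour-child v⋖p)))))

    -- Below the root nothing is skipped, and positions stay under `m`. Below any other vertex
    -- skipping the parent's colour costs at most one, which the strict bound on its children
    -- allows.
    colour-< : ∀ {u p} → u ⋖ p → colour u < m
    colour-< {u} {p} u⋖p with p ≟F r
    ... | yes refl = subst (_< m)
      (≡-sym (trans (colour-child u⋖p)
        (trans (cong (λ c → skip c (position u)) (colourWithin-root (rankT r)))
               (skip-below (<-≤-trans (position<#children u⋖p) root≤m)))))
      (<-≤-trans (position<#children u⋖p) root≤m)
    ... | no p≢r   = subst (_< m) (≡-sym (colour-child u⋖p))
      (≤-<-trans (skip-≤ (colour p) (position u))
        (≤-<-trans (position<#children u⋖p) (others<m p≢r)))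

    edgeColour : Fin n → Fin n → Fin m
    edgeColour u w with childOf? T u w | childOf? T w u
    ... | yes u⋖w | _       = fromℕ< (colour-< u⋖w)
    ... | no _    | yes w⋖u = fromℕ< (colour-< w⋖u)
    -- An arbitrary colour for pairs outside the tree.
    ... | no _    | no _    = fromℕ< (<-≤-trans (s≤s z≤n) 2≤m)

    edgeColour-sym : ∀ u w → edgeColour u w ≡ edgeColour w u
    edgeColour-sym u w with childOf? T u w | childOf? T w u
    ... | yes u⋖w | yes w⋖u = contradiction w⋖u (ChildOf-asym T u⋖w)
    ... | yes _   | no _    = refl
    ... | no _    | yes _   = refl
    ... | no _    | no _    = refl

    toℕ-edgeColour : ∀ {u w} → u ⋖ w → toℕ (edgeColour u w) ≡ colour u
    toℕ-edgeColour {u} {w} u⋖w with childOf? T u w | childOf? T w u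
    ... | yes p | _ = toℕ-fromℕ< (colour-< p)
    ... | no ¬p | _ = contradiction u⋖w ¬p

    colouring : EdgeColouring G m
    colouring = record { col = edgeColour ; col-sym = edgeColour-sym }

    toℕ-edgeColour′ : ∀ {u w} → u ⋖ w → toℕ (edgeColour w u) ≡ colour u
    toℕ-edgeColour′ {u} {w} u⋖w = trans (cong toℕ (edgeColour-sym w u)) (toℕ-edgeColour u⋖w)

    colouring-proper : ProperTree {G = G} colouring (Edge T)
    colouring-proper {u} {v} {w} e f u≢w eq = separate e f (cong toℕ eq)
      where
      separate : Edge T u v → Edge T v w → toℕ (edgeColour u v) ≢ toℕ (edgeColour v w)
      separate (inj₁ u⋖v) (inj₁ v⋖w) eq = colour-≢-parent u⋖v
        (trans (≡-sym (toℕ-edgeColour u⋖v)) (trans eq (toℕ-edgeColour v⋖w)))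
      separate (inj₁ u⋖v) (inj₂ w⋖v) eq = colour-≢-sibling u⋖v w⋖v u≢w
        (trans (≡-sym (toℕ-edgeColour u⋖v)) (trans eq (toℕ-edgeColour′ w⋖v)))
      separate (inj₂ v⋖u) (inj₁ v⋖w) eq = u≢w (ChildOf-functional T v⋖u v⋖w)
      separate (inj₂ v⋖u) (inj₂ w⋖v) eq = colour-≢-parent w⋖v
        (trans (≡-sym (toℕ-edgeColour′ w⋖v)) (trans (≡-sym eq) (toℕ-edgeColour′ v⋖u)))

    spanningTree⇒px3≤ : px3≤ G m
    spanningTree⇒px3≤ = colouring , λ _ _ _ _ _ _ →
      (λ _ → ⊤) , Edge T , Edge-isTree T , tt , tt , tt ,
      λ {u} {v} {w} → colouring-proper {u} {v} {w}

  -- Hanging one vertex below a new parent.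

  module _ {r : Fin n} (T : SpanningTree r) where

    -- The new rank certifies that the change of parent creates no cycle, so descendants need not be
    -- discussed.
    record Move : Set where
      field
        moved target : Fin n
        target-adj   : Adj G moved target
        newRank      : Fin n → ℕ

      newPar : Fin n → Fin n
      newPar = updateAt (par T) moved (const target)

      field
        newRank-par : ∀ {u} → u ≢ r → newRank (newPar u) < newRank u

    module _ (M : Move) where

      open Move M renaming (moved to b; target to a)

      reparent : SpanningTree r
      reparent = record
        { par      = newPar
        ; rank     = newRank
        ; par-adj  = newPar-adj _
        ; par-rank = newRank-par
        }
        where
        newPar-adj : ∀ u → u ≢ r → Adj G u (newPar u)
        newPar-adj u u≢r with u ≟F b
        ... | yes refl = subst (Adj G b) (≡-sym (updateAt-updates b (par T))) target-adj
        ... | no u≢b   =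
          subst (Adj G u) (≡-sym (updateAt-minimal u b (par T) u≢b)) (par-adj T u≢r)

      reparent-ChildOf : ∀ {u w} → ChildOf reparent u w → (u ≡ b × w ≡ a) ⊎ (u ≢ b × ChildOf T u w)
      reparent-ChildOf {u} (u≢r , eq) with u ≟F b
      ... | yes refl = inj₁ (refl , trans (≡-sym eq) (updateAt-updates b (par T)))
      ... | no u≢b   = inj₂ (u≢b , u≢r , trans (≡-sym (updateAt-minimal u b (par T) u≢b)) eq)

      reparent-children-new : #children reparent a ≤ suc (#children T a)
      reparent-children-new = Unique-⊆⇒length≤ (children-unique reparent a) sub
        where
        sub : children reparent a ⊆ b ∷ children T a
        sub u∈ with reparent-ChildOf (∈-children⁻ reparent u∈)
        ... | inj₁ (refl , _) = here refl
        ... | inj₂ (_ , u⋖a)  = there (∈-children⁺ T u⋖a)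

      reparent-children-other : ∀ {w} → w ≢ a → #children reparent w ≤ #children T w
      reparent-children-other {w} w≢a = Unique-⊆⇒length≤ (children-unique reparent w) sub
        where
        sub : children reparent w ⊆ children T w
        sub u∈ with reparent-ChildOf (∈-children⁻ reparent u∈)
        ... | inj₁ (_ , w≡a)  = contradiction w≡a w≢a
        ... | inj₂ (_ , u⋖w)  = ∈-children⁺ T u⋖w

      reparent-children-old : ∀ {p} → ChildOf T b p → p ≢ a → #children reparent p < #children T p
      reparent-children-old {p} b⋖p p≢a =
        Unique-⊆⇒length≤ (∉⇒Unique-∷ b∉ (children-unique reparent p)) sub
        where
        b∉ : b ∉ children reparent p
        b∉ b∈ with reparent-ChildOf (∈-children⁻ reparent b∈)
        ... | inj₁ (_ , p≡a) = p≢a p≡a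
        ... | inj₂ (b≢b , _) = b≢b refl
        sub : b ∷ children reparent p ⊆ children T p
        sub (here refl) = ∈-children⁺ T b⋖p
        sub (there u∈) with reparent-ChildOf (∈-children⁻ reparent u∈)
        ... | inj₁ (_ , p≡a)  = contradiction p≡a p≢a
        ... | inj₂ (_ , u⋖p)  = ∈-children⁺ T u⋖p

    module _ {l : Fin n} (leaf : #children T l ≡ 0) where

      par≢leaf : ∀ {u} → u ≢ r → par T u ≢ l
      par≢leaf u≢r eq =
        contradiction (subst (0 <_) leaf (∈-length (∈-children⁺ T (u≢r , eq)))) λ ()

      -- Doubling makes room for the leaf just above p and below all the
      -- vertices of larger rank.
      rankAbove : Fin n → Fin n → ℕ
      rankAbove p = updateAt (λ u → 2 * rank T u) l (const (suc (2 * rank T p)))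

      rankAbove-leaf : ∀ p → rankAbove p l ≡ suc (2 * rank T p)
      rankAbove-leaf p = updateAt-updates l _

      rankAbove-other : ∀ p {u} → u ≢ l → rankAbove p u ≡ 2 * rank T u
      rankAbove-other p {u} u≢l = updateAt-minimal u l _ u≢l

      rankAbove-p<leaf : ∀ {p} → p ≢ l → rankAbove p p < rankAbove p l
      rankAbove-p<leaf {p} p≢l
        rewrite rankAbove-leaf p | rankAbove-other p p≢l = ≤-refl

      -- With `p` the parent of `u`, `2 * rank p + 1` is less than `2 * (rank p + 1)`, which is at
      -- most `2 * rank u`.
      rankAbove-leaf<child : ∀ {u} → u ≢ r → u ≢ l → rankAbove (par T u) l < rankAbove (par T u) u
      rankAbove-leaf<child {u} u≢r u≢l
        rewrite rankAbove-leaf (par T u) | rankAbove-other (par T u) u≢l =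
        subst (_≤ 2 * rank T u) (*-suc 2 (rank T (par T u))) (*-monoʳ-≤ 2 (par-rank T u≢r))

      rankAbove-par : ∀ p {u} → u ≢ r → u ≢ l → rankAbove p (par T u) < rankAbove p u
      rankAbove-par p {u} u≢r u≢l
        rewrite rankAbove-other p (par≢leaf u≢r) | rankAbove-other p u≢l =
        *-monoʳ-< 2 (par-rank T u≢r)

      -- No vertex has the leaf as parent, so the only new inequality is the one between `x` and
      -- `l`.
      moveLeaf : ∀ {x} → x ≢ l → Adj G l x → Move
      moveLeaf {x} x≢l adj = record
        { moved = l ; target = x ; target-adj = adj
        ; newRank = rankAbove x ; newRank-par = decreasing }
        where
        decreasing : ∀ {u} → u ≢ r → rankAbove x (updateAt (par T) l (const x) u) < rankAbove x u
        decreasing {u} u≢r with u ≟F l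
        ... | yes refl rewrite updateAt-updates l {const x} (par T) = rankAbove-p<leaf x≢l
        ... | no u≢l   rewrite updateAt-minimal u l {const x} (par T) u≢l = rankAbove-par x u≢r u≢l

      -- Both `l` and `x` hang below `r`, so a rank for `l` just above that of `r` is still below
      -- that of `x`.
      moveBelowLeaf : ∀ {x} → ChildOf T l r → ChildOf T x r → x ≢ l → Adj G x l → Move
      moveBelowLeaf {x} (l≢r , l⋖r) (x≢r , x⋖r) x≢l adj = record
        { moved = x ; target = l ; target-adj = adj
        ; newRank = rankAbove r ; newRank-par = decreasing }
        where
        decreasing : ∀ {u} → u ≢ r → rankAbove r (updateAt (par T) x (const l) u) < rankAbove r u
        decreasing {u} u≢r with u ≟F x
        ... | yes refl rewrite updateAt-updates x {const l} (par T) =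
          subst (λ p → rankAbove p l < rankAbove p x) x⋖r (rankAbove-leaf<child x≢r x≢l)
        ... | no u≢x rewrite updateAt-minimal u x {const l} (par T) u≢x with u ≟F l
        ...   | yes refl = subst (λ p → rankAbove r p < rankAbove r l) (≡-sym l⋖r)
                             (rankAbove-p<leaf (l≢r ∘ ≡-sym))
        ...   | no u≢l   = rankAbove-par r u≢r u≢l

  -- Lowering the degree of the root.

  record Improvement {r : Fin n} (m : ℕ) (T : SpanningTree r) : Set where
    field
      tree     : SpanningTree r
      smaller  : #children tree r < #children T r
      branches : BranchesBelow m tree

  -- The target gains at most one child and must stay strictly below `m`; hence the `2`.
  reparent-improves : ∀ {r m} (T : SpanningTree r) → BranchesBelow m T → (M : Move T) →
    ChildOf T (Move.moved M) r → Move.target M ≢ r → 2 + #children T (Move.target M) ≤ m →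
    Improvement m T
  reparent-improves {r} {m} T others M b⋖r a≢r a≤ = record
    { tree     = reparent T M
    ; smaller  = reparent-children-old T M b⋖r (a≢r ∘ ≡-sym)
    ; branches = branches
    }
    where
    branches : BranchesBelow m (reparent T M)
    branches {u} u≢r with u ≟F Move.target M
    ... | yes refl = ≤-trans (s≤s (reparent-children-new T M)) a≤
    ... | no u≢a   = ≤-<-trans (reparent-children-other T M u≢a) (others u≢r)

  -- There is a third vertex, and a walk from `u` to it avoids `r`; its first step gives the
  -- neighbour.
  neighbour-avoiding : TwoConnected G → ∀ {u r} → u ≢ r → ∃ λ x → Adj G u x × x ≢ r
  neighbour-avoiding (3≤n , _ , without) {u} {r} u≢r
    with any? (λ y → ¬? (y ≟F u) ×-dec ¬? (y ≟F r))
  ... | no ¬third = contradiction 3≤n (<⇒≱ (s≤s n≤2))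
    where
    covered : allFin n ⊆ u ∷ r ∷ []
    covered {y} _ with y ≟F u | y ≟F r
    ... | yes refl | _        = here refl
    ... | no _     | yes refl = there (here refl)
    ... | no y≢u   | no y≢r   = contradiction (y , y≢u , y≢r) ¬third
    n≤2 : n ≤ 2
    n≤2 = subst (_≤ 2) (length-tabulate {n = n} (λ i → i)) (Unique-⊆⇒length≤ (allFin⁺ n) covered)
  ... | yes (y , y≢u , y≢r) with without r u y u≢r y≢r
  ...   | here                           = contradiction refl y≢u
  ...   | step {v = x} (adj , _ , x≢r) _ = x , adj , x≢r

  module _ (2conn : TwoConnected G) {m : ℕ} (2≤m : 2 ≤ m) (n≤1+m+m : n ≤ suc (m + m)) where

    improve : ∀ {r} (T : SpanningTree r) → BranchesBelow m T → m < #children T r → Improvement m T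
    improve {r} T others m<d
      with leaf-below-root T (≤-<-trans n≤1+m+m (s≤s (+-mono-<-≤ m<d (<⇒≤ m<d))))
    ... | l , l⋖r , leaf with neighbour-avoiding 2conn (proj₁ l⋖r)
    ...   | x , adj , x≢r = reattach (childOf? T x r)
      where
      x≢l : x ≢ l
      x≢l refl = irrefl G adj
      reattach : Dec (ChildOf T x r) → Improvement m T
      -- The target `l` has no children, so `2 ≤ m` is enough room.
      reattach (yes x⋖r) = reparent-improves T others
        (moveBelowLeaf T leaf l⋖r x⋖r x≢l (sym G adj)) x⋖r (proj₁ l⋖r)
        (subst (λ k → 2 + k ≤ m) (≡-sym leaf) 2≤m)
      -- The root has at least `m + 1` children. Together with `r`, `x` and the children of `x`
      -- these are distinct vertices, at most `2 * m + 1` in all.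
      reattach (no ¬x⋖r) = reparent-improves T others (moveLeaf T leaf x≢l adj) l⋖r x≢r
        (+-cancelˡ-≤ (suc m) _ _ (begin
          suc m + (2 + #children T x)             ≡⟨ +-comm (suc m) _ ⟩
          2 + (#children T x + suc m)             ≤⟨ +-monoʳ-≤ 2 (+-monoʳ-≤ (#children T x) m<d) ⟩
          2 + (#children T x + #children T r)     ≡⟨ cong (2 +_) (+-comm (#children T x) _) ⟩
          2 + (#children T r + #children T x)     ≤⟨ children-of-root+children<n-1 T x≢r ¬x⋖r ⟩
          n                                       ≤⟨ n≤1+m+m ⟩
          suc m + m                               ∎))
        where open ≤-Reasoning

    -- Induction on `k`, a bound for the excess of the root's degree over `m`; every improvement
    -- lowers it.
    px3≤-from-tree : ∀ {r} k (T : SpanningTree r) → BranchesBelow m T → #children T r ≤ k + m → px3≤ G m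
    px3≤-from-tree {r} k T others d≤ with #children T r ≤? m
    ... | yes d≤m = ProperColouring.spanningTree⇒px3≤ T 2≤m d≤m others
    px3≤-from-tree zero    T others d≤ | no d≰m = contradiction d≤ d≰m
    px3≤-from-tree (suc k) T others d≤ | no d≰m =
      let open Improvement (improve T others (≰⇒> d≰m)) in
      px3≤-from-tree k tree branches (≤-pred (<-≤-trans smaller d≤))

  -- Changing the root.

  rerootAtChild : ∀ {r} (T : SpanningTree r) {c} → ChildOf T c r →
    Σ (SpanningTree c) λ T′ → ∀ {u w} → ChildOf T u w → Edge T′ u w
  rerootAtChild {r} T {c} c⋖r@(c≢r , parc) = T′ , edges
    where
    par′ = updateAt (par T) r (const c)
    -- All other ranks go up by one, so that the new root `c` can take zero.
    rank′ = updateAt (suc ∘ rank T) c (const 0)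

    rank′-other : ∀ {u} → u ≢ c → rank′ u ≡ suc (rank T u)
    rank′-other {u} u≢c = updateAt-minimal u c _ u≢c

    par′-adj : ∀ u → u ≢ c → Adj G u (par′ u)
    par′-adj u u≢c with u ≟F r
    ... | yes refl rewrite updateAt-updates r {const c} (par T) =
      subst (λ v → Adj G v c) parc (sym G (par-adj T c≢r))
    ... | no u≢r rewrite updateAt-minimal u r {const c} (par T) u≢r = par-adj T u≢r

    rank′-c : ∀ {u} → u ≢ c → rank′ c < rank′ u
    rank′-c u≢c rewrite updateAt-updates c {const 0} (suc ∘ rank T) | rank′-other u≢c = s≤s z≤n

    par′-rank : ∀ u → u ≢ c → rank′ (par′ u) < rank′ u
    par′-rank u u≢c with u ≟F r
    ... | yes refl rewrite updateAt-updates r {const c} (par T) = rank′-c u≢c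
    ... | no u≢r rewrite updateAt-minimal u r {const c} (par T) u≢r with par T u ≟F c
    ...   | yes eq = subst (λ p → rank′ p < rank′ u) (≡-sym eq) (rank′-c u≢c)
    ...   | no p≢c rewrite rank′-other u≢c | rank′-other p≢c = s≤s (par-rank T u≢r)

    T′ : SpanningTree c
    T′ = record { par = par′ ; rank = rank′ ; par-adj = par′-adj _ ; par-rank = par′-rank _ }

    edges : ∀ {u w} → ChildOf T u w → Edge T′ u w
    edges {u} (u≢r , eq) with u ≟F c
    -- The only edge that changes direction: here `w` is the old root.
    ... | yes refl = inj₂ ( (λ w≡c → c≢r (trans (≡-sym w≡c) (trans (≡-sym eq) parc)))
                          , subst (λ w → par′ w ≡ c) (trans (≡-sym parc) eq) (updateAt-updates r (par T)))
    ... | no u≢c   = inj₁ (u≢c , trans (updateAt-minimal u r (par T) u≢r) eq)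

  -- The root is moved along the path to `v`: first to the parent of `v`, then one edge further.
  -- Keeping track of edges is enough to compare degrees.
  reroot : ∀ {r} (T : SpanningTree r) k v → rank T v < k →
    Σ (SpanningTree v) λ T′ → ∀ {u w} → ChildOf T u w → Edge T′ u w
  reroot {r} T (suc k) v (s≤s ≤k) with v ≟F r
  ... | yes refl = T , inj₁
  ... | no v≢r with reroot T k (par T v) (<-≤-trans (par-rank T v≢r) ≤k)
  ...   | T₁ , edges₁ with edges₁ (v≢r , refl)
  -- The parent of `v` is now the root, hence nobody's child.
  ...     | inj₂ (p≢p , _) = contradiction refl p≢p
  ...     | inj₁ v⋖p with rerootAtChild T₁ v⋖p
  ...       | T₂ , edges₂ = T₂ , edges
    where
    edges : ∀ {u w} → ChildOf T u w → Edge T₂ u w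
    edges e with edges₁ e
    ... | inj₁ f = edges₂ f
    ... | inj₂ f = Edge-sym T₂ (edges₂ f)

  -- As root, `v` has its former parent as a further child.
  reroot-children : ∀ {r} (T : SpanningTree r) {v} → v ≢ r →
    Σ (SpanningTree v) λ T′ → #children T v < #children T′ v
  reroot-children T {v} v≢r with reroot T _ v ≤-refl
  ... | T′ , edges = T′ , Unique-⊆⇒length≤ (∉⇒Unique-∷ par∉ (children-unique T v)) sub
    where
    par∉ : par T v ∉ children T v
    par∉ p∈ = ChildOf-asym T (v≢r , refl) (∈-children⁻ T p∈)
    toRoot : ∀ {u} → Edge T′ u v → u ∈ children T′ v
    toRoot (inj₁ u⋖v)       = ∈-children⁺ T′ u⋖v
    toRoot (inj₂ (v≢v , _)) = contradiction refl v≢v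
    sub : par T v ∷ children T v ⊆ children T′ v
    sub (here refl) = toRoot (Edge-sym T′ (edges (v≢r , refl)))
    sub (there u∈)  = toRoot (edges (∈-children⁻ T u∈))

  -- Existence of a spanning tree.

  record PartialTree (r : Fin n) (S : List (Fin n)) : Set where
    field
      root∈    : r ∈ S
      par      : Fin n → Fin n
      rank     : Fin n → ℕ
      par∈     : ∀ {u} → u ∈ S → u ≢ r → par u ∈ S
      par-adj  : ∀ {u} → u ∈ S → u ≢ r → Adj G u (par u)
      par-rank : ∀ {u} → u ∈ S → u ≢ r → rank (par u) < rank u

  extend : ∀ {r S a b} → PartialTree r S → Adj G a b → a ∈ S → b ∉ S → PartialTree r (b ∷ S)
  extend {r} {S} {a} {b} P adj a∈ b∉ = record
    { root∈    = there P.root∈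
    ; par      = par′
    ; rank     = rank′
    ; par∈     = par′∈
    ; par-adj  = par′-adj
    ; par-rank = par′-rank
    }
    where
    module P = PartialTree P
    par′ = updateAt P.par b (const a)
    rank′ = updateAt P.rank b (const (suc (P.rank a)))
    S≢b : ∀ {u} → u ∈ S → u ≢ b
    S≢b u∈ refl = b∉ u∈
    par′∈ : ∀ {u} → u ∈ b ∷ S → u ≢ r → par′ u ∈ b ∷ S
    par′∈ (here refl) _ rewrite updateAt-updates b {const a} P.par = there a∈
    par′∈ {u} (there u∈) u≢r rewrite updateAt-minimal u b {const a} P.par (S≢b u∈) =
      there (P.par∈ u∈ u≢r)
    par′-adj : ∀ {u} → u ∈ b ∷ S → u ≢ r → Adj G u (par′ u)
    par′-adj (here refl) _ rewrite updateAt-updates b {const a} P.par = sym G adj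
    par′-adj {u} (there u∈) u≢r rewrite updateAt-minimal u b {const a} P.par (S≢b u∈) =
      P.par-adj u∈ u≢r
    rank′-S : ∀ {u} → u ∈ S → rank′ u ≡ P.rank u
    rank′-S {u} u∈ = updateAt-minimal u b P.rank (S≢b u∈)
    par′-rank : ∀ {u} → u ∈ b ∷ S → u ≢ r → rank′ (par′ u) < rank′ u
    par′-rank (here refl) _
      rewrite updateAt-updates b {const a} P.par
            | updateAt-updates b {const (suc (P.rank a))} P.rank
            | rank′-S a∈ = ≤-refl
    par′-rank {u} (there u∈) u≢r
      rewrite updateAt-minimal u b {const a} P.par (S≢b u∈)
            | rank′-S u∈ | rank′-S (P.par∈ u∈ u≢r) = P.par-rank u∈ u≢r

  spanningTree : Connected G → ∀ r → SpanningTree r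
  spanningTree conn r = grow n (r ∷ []) ([] ∷ []) (m≤m+n n 1) record
    { root∈    = here refl
    ; par      = λ _ → r
    ; rank     = λ _ → 0
    ; par∈     = λ { (here refl) r≢r → contradiction refl r≢r }
    ; par-adj  = λ { (here refl) r≢r → contradiction refl r≢r }
    ; par-rank = λ { (here refl) r≢r → contradiction refl r≢r }
    }
    where
    grow : ∀ k S → Unique S → n ≤ k + length S → PartialTree r S → SpanningTree r
    grow k S S! n≤ P with any? (λ u → ¬? (u ∈? S))
    ... | no all∈ = record
      { par = P.par ; rank = P.rank
      ; par-adj = P.par-adj (∈S _) ; par-rank = P.par-rank (∈S _) }
      where
      module P = PartialTree P
      ∈S : ∀ u → u ∈ S
      ∈S u = decidable-stable (u ∈? S) λ u∉ → all∈ (u , u∉)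
    -- `S` already has at least `n` distinct entries, so there is no room for `u`.
    grow zero S S! n≤ P | yes (u , u∉) =
      contradiction (Unique⇒length≤n (∉⇒Unique-∷ u∉ S!)) (≤⇒≯ n≤)
    grow (suc k) S S! n≤ P | yes (u , u∉)
      with Reach-leaves (_∈? S) (conn r u) (PartialTree.root∈ P) u∉
    ... | a , b , adj , a∈ , b∉ = grow k (b ∷ S) (∉⇒Unique-∷ b∉ S!)
      (subst (n ≤_) (≡-sym (+-suc k (length S))) n≤) (extend P adj a∈ b∉)

  -- Choice of the root and conclusion.

  px3≤-2connected : TwoConnected G → ∀ {m} → 2 ≤ m → n ≤ suc (m + m) → Fin n → px3≤ G m
  px3≤-2connected 2conn@(_ , conn , _) {m} 2≤m n≤ r
    with spanningTree conn r
  -- A vertex other than `r` with `m` children has degree above `m`. If there is one, it becomes the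
  -- root, and counting bounds all other vertices.
  ... | T with any? (λ v → ¬? (v ≟F r) ×-dec (m ≤? #children T v))
  ...   | no none = px3≤-from-tree 2conn 2≤m n≤ (#children T r) T
            (λ u≢r → ≰⇒> λ m≤ → none (_ , u≢r , m≤)) (m≤m+n _ m)
  ...   | yes (v , v≢r , m≤) with reroot-children T v≢r
  ...     | T′ , d< = px3≤-from-tree 2conn 2≤m n≤ (#children T′ v) T′ others (m≤m+n _ m)
    where
    others : BranchesBelow m T′
    others {u} u≢v = +-cancelˡ-< (suc m) _ _ (begin-strict
      suc m + #children T′ u           ≤⟨ +-monoˡ-≤ (#children T′ u) (≤-<-trans m≤ d<) ⟩
      #children T′ v + #children T′ u  <⟨ children-of-root+children<n T′ u≢v ⟩
      n                                ≤⟨ n≤ ⟩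
      suc m + m                        ∎)
      where open ≤-Reasoning

theorem4p1 : (n : ℕ) (G : Graph n) → 4 ≤ n → TwoConnected G →
    ¬ Hamiltonian G → px3≤ G (n / 2)
theorem4p1 n G 4≤n 2conn _ = px3≤-2connected G 2conn
  -- `4 / 2` computes to `2`; the last argument is the initial root, vertex zero.
  (/-monoˡ-≤ 2 4≤n) (n≤1+[n/2]+[n/2] n) (fromℕ< (<-≤-trans (s≤s z≤n) 4≤n))
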